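{- Let $(X;\leq)$ be a poset. (a) If every order component of $X$ (with the induced order) is representable, then $X$ is representable. (b) If $X$ is representable, then every order component $Y$ of $X$ is compact with respect to its own interval topology $\tau_i(Y)$. (c) There exists a representable poset having an order component which (with the induced order) is not representable.
   Context: A poset is representable if it is order-isomorphic to the poset of prime ideals (ordered by inclusion) of a bounded distributive lattice; equivalently, $(X;\leq)$ is representable iff there is a topology $\tau$ on $X$ such that $(X;\tau,\leq)$ is a Priestley space, i.e. $(X;\tau)$ is compact and whenever $x\not\geq y$ there is a clopen down-set $U$ with $x\in U$, $y\notin U$. For a poset $X$, let $R=\{(x,y): x\le y \text{ or } y\le x\}$ and $R'$ its transitive closure; an order component of $X$ is an equivalence class of $R'$. For $x\in X$, $(x]=\{z: z\le x\}$, $[x)=\{z: z\ge x\}$. The interval topology $\tau_i(X)$ is the topology with subbase $\{X\setminus (x]: x\in X\}\cup\{X\setminus [x): x\in X\}$. -}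

module Defs where

open import Level using (Level; _⊔_; suc)
open import Algebra.Definitions using (_DistributesOverˡ_)
open import Data.List.Base using (List)
open import Data.List.Relation.Unary.All using (All)
open import Data.List.Relation.Unary.Any using (Any)
open import Data.Product.Base using (Σ; Σ-syntax; ∃; _×_; _,_; proj₁; proj₂)
open import Data.Sum.Base using (_⊎_; inj₁; inj₂)
open import Function.Base using (id)
open import Relation.Binary.Bundles using (Setoid; Poset)
open import Relation.Binary.Construct.Closure.Transitive using (TransClosure)
import Relation.Binary.Construct.On as On
open import Relation.Binary.Core using (Rel)
open import Relation.Binary.Lattice.Bundles using (BoundedLattice)
open import Relation.Binary.Morphism.Structures using (IsOrderIsomorphism)
open import Relation.Binary.PropositionalEquality.Core using (_≡_)
open import Relation.Unary using (Pred; _∈_; _∉_; _⊆_; _≐_; ∁)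

-- The axiom of choice, as the existence of a system of representatives for
-- every equivalence relation.  The result is required up to _≡_: choosing
-- from a Σ-type is trivial in type theory, and the content of the axiom is
-- that the choice depends on the equivalence class only.
AxiomOfChoice : ∀ ℓ → Set (suc ℓ)
AxiomOfChoice ℓ = (S : Setoid ℓ ℓ) → let open Setoid S in
  Σ[ rep ∈ (Carrier → Carrier) ]
    (∀ x → rep x ≈ x) × (∀ {x y} → x ≈ y → rep x ≡ rep y)

record BoundedDistributiveLattice c ℓ₁ ℓ₂ : Set (suc (c ⊔ ℓ₁ ⊔ ℓ₂)) where
  field
    boundedLattice : BoundedLattice c ℓ₁ ℓ₂
  open BoundedLattice boundedLattice public
  field
    ∧-distribˡ-∨ : _DistributesOverˡ_ _≈_ _∧_ _∨_

module _ {ℓ : Level} (L : BoundedDistributiveLattice ℓ ℓ ℓ) where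
  open BoundedDistributiveLattice L

  record IsIdeal (I : Pred Carrier ℓ) : Set ℓ where
    field
      nonempty    : ∃ λ a → a ∈ I
      down-closed : ∀ {a b} → a ≤ b → b ∈ I → a ∈ I
      ∨-closed    : ∀ {a b} → a ∈ I → b ∈ I → a ∨ b ∈ I

  record IsPrimeIdeal (I : Pred Carrier ℓ) : Set ℓ where
    field
      isIdeal : IsIdeal I
      proper  : ∃ λ a → a ∉ I
      prime   : ∀ {a b} → a ∧ b ∈ I → a ∈ I ⊎ b ∈ I
    open IsIdeal isIdeal public

  PrimeIdeal : Set (suc ℓ)
  PrimeIdeal = Σ (Pred Carrier ℓ) IsPrimeIdeal

  primeIdealPoset : Poset (suc ℓ) ℓ ℓ
  primeIdealPoset = record
    { Carrier = PrimeIdeal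
    ; _≈_ = λ I J → proj₁ I ≐ proj₁ J
    ; _≤_ = λ I J → proj₁ I ⊆ proj₁ J
    ; isPartialOrder = record
      { isPreorder = record
        { isEquivalence = record
          { refl  = id , id
          ; sym   = λ (p , q) → q , p
          ; trans = λ (p , q) (r , s) → (λ z → r (p z)) , (λ z → q (s z))
          }
        ; reflexive = proj₁
        ; trans     = λ p q z → q (p z)
        }
      ; antisym = _,_
      }
    }

module _ {c₁ ℓ₁ m₁ c₂ ℓ₂ m₂ : Level} where

  OrderIsomorphic : Poset c₁ ℓ₁ m₁ → Poset c₂ ℓ₂ m₂ →
                    Set (c₁ ⊔ ℓ₁ ⊔ m₁ ⊔ c₂ ⊔ ℓ₂ ⊔ m₂)
  OrderIsomorphic P Q =
    ∃ (IsOrderIsomorphism (Poset._≈_ P) (Poset._≈_ Q) (Poset._≤_ P) (Poset._≤_ Q))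

Representable : ∀ {ℓ} → Poset ℓ ℓ ℓ → Set (suc ℓ)
Representable {ℓ} X =
  Σ[ L ∈ BoundedDistributiveLattice ℓ ℓ ℓ ] OrderIsomorphic X (primeIdealPoset L)

-- Openness of a subset in the topology with subbase S: every point of U lies
-- in a finite intersection of members of S contained in U (the empty
-- intersection being the whole space).
OpenFromSubbase : ∀ {ℓ} {A K : Set ℓ} → (K → Pred A ℓ) → Pred (Pred A ℓ) ℓ
OpenFromSubbase {K = K} S U = ∀ {x} → x ∈ U →
  Σ[ ks ∈ List K ] (x ∈ ⋂ ks × ⋂ ks ⊆ U)
  where
  ⋂ : List K → Pred _ _
  ⋂ ks x = All (λ k → x ∈ S k) ks

Compact : ∀ {ℓ} {A : Set ℓ} → Pred (Pred A ℓ) ℓ → Set (suc ℓ)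
Compact {ℓ} {A} Open =
  {I : Set ℓ} (U : I → Pred A ℓ) → (∀ i → Open (U i)) →
  (∀ x → ∃ λ i → x ∈ U i) →
  Σ[ is ∈ List I ] (∀ x → Any (λ i → x ∈ U i) is)

module _ {ℓ : Level} (X : Poset ℓ ℓ ℓ) where
  open Poset X

  Comparable : Rel Carrier ℓ
  Comparable x y = x ≤ y ⊎ y ≤ x

  IsOrderComponent : Pred (Pred Carrier ℓ) ℓ
  IsOrderComponent Y = ∃ λ x → Y ≐ TransClosure Comparable x

  induced : Pred Carrier ℓ → Poset ℓ ℓ ℓ
  induced Y = On.poset X (proj₁ {B = Y})

  ↓ ↑ : Carrier → Pred Carrier ℓ
  ↓ x z = z ≤ x
  ↑ x z = x ≤ z

  intervalSubbase : Carrier ⊎ Carrier → Pred Carrier ℓ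
  intervalSubbase (inj₁ x) = ∁ (↓ x)
  intervalSubbase (inj₂ x) = ∁ (↑ x)

  IntervalOpen : Pred (Pred Carrier ℓ) ℓ
  IntervalOpen = OpenFromSubbase intervalSubbase

{-# OPTIONS --safe #-}
module Submission where

-- (a) Topologically, the disjoint union of the components is compactified by
-- letting all components but one converge to a chosen point x₀ of that one.
--
-- (b) The pointwise limit of prime ideals along an ultrafilter is a prime ideal,
-- and it inherits the bounds that hold for most of them.  Hence an ultrafilter on
-- Y that contains some (x] or [x) with x ∈ Y has its limit in Y.
--
-- (c) Order the finite sequences of naturals so that the children σ0, σ1, … of a
-- node σ form a chain, increasing to σ when σ has even length and decreasing to σ
-- when it has odd length.  Adding the infinite sequences as points comparable only
-- to themselves gives a closed set of valuations, hence a representable poset, in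
-- which the finite sequences are a component.  That component is countable, and
-- each of its points is the limit of a chain, which forces every point to be
-- non-isolated in any representing topology; by Baire this is impossible.

open import Defs
open import Axiom.ExcludedMiddle using (ExcludedMiddle)
open import Data.Empty using (⊥; ⊥-elim)
open import Data.Bool.Base as Bool using (Bool; true; false; not; if_then_else_)
open import Data.Bool.Properties as Bool using (∧-conicalˡ; ∧-conicalʳ; ∧-identityʳ; ∧-zeroʳ; ¬-not; not-¬)
open import Data.List.Base using (List; []; _∷_; _++_; _∷ʳ_; map)
open import Data.List.Relation.Unary.All as All using (All; []; _∷_)
import Data.List.Relation.Unary.All.Properties as All
open import Data.List.Relation.Unary.Any using (Any)
open import Data.Maybe.Base using (Maybe; just; nothing)
open import Data.Nat.Base as ℕ using (ℕ; zero; suc; _⊔_; z≤n; s≤s)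
open import Data.Nat.Binary.Base using (ℕᵇ; 2[1+_]; 1+[2_]; toℕ; fromℕ)
open import Data.Nat.Binary.Properties using (fromℕ-toℕ)
open import Data.Nat.Properties as ℕ using (_≟_; _≤?_; m≤m⊔n; m≤n⊔m; m≤n⇒m<n∨m≡n)
open import Data.Product.Base using (Σ; Σ-syntax; ∃; _×_; _,_; proj₁; proj₂)
open import Data.Sum.Base as Sum using (_⊎_; inj₁; inj₂)
open import Data.Unit.Polymorphic.Base using (⊤; tt)
open import Function.Base using (id; _∘_; flip)
open import Level using (Level; Lift; lift; lower; 0ℓ) renaming (suc to lsuc)
open import Relation.Binary.Bundles using (Poset; Setoid)
open import Relation.Binary.Construct.Closure.Transitive using (TransClosure; [_]; _∷_; symmetric) renaming (_++_ to _⁺++⁺_; _∷ʳ_ to _⁺∷ʳ_)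
open import Relation.Binary.Morphism.Structures using (IsOrderIsomorphism)
open import Relation.Binary.PropositionalEquality.Core using (_≡_; _≢_; refl; sym; trans; cong; subst)
open import Relation.Nullary using (Dec; yes; no; does; contradiction)
open import Relation.Nullary.Decidable using (dec-true; dec-false; map′)
open import Relation.Nullary.Negation.Core using (¬_)
open import Relation.Unary using (Pred; _∈_; _∉_; _⊆_; _≐_; _∩_; ∁)

private
  variable
    ℓ : Level

-- Prime ideals and pointwise approximation

Agree : {G : Set ℓ} → Pred G ℓ → Pred G ℓ → Pred G ℓ
Agree P Q g = (P g → Q g) × (Q g → P g)

module Representation (X : Poset ℓ ℓ ℓ) (R : Representable X) where
  open Poset X using (Carrier; _≤_)
  L : BoundedDistributiveLattice ℓ ℓ ℓ
  L = proj₁ R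

  open BoundedDistributiveLattice L public using () renaming (Carrier to Element)

  point : Carrier → PrimeIdeal L
  point = proj₁ (proj₂ R)

  open IsOrderIsomorphism (proj₂ (proj₂ R)) using (mono; cancel; surjective)

  ideal : Carrier → Pred Element ℓ
  ideal x = proj₁ (point x)

  ideal-mono : ∀ {x y} → x ≤ y → ideal x ⊆ ideal y
  ideal-mono = mono

  ideal-cancel : ∀ {x y} → ideal x ⊆ ideal y → x ≤ y
  ideal-cancel = cancel

  ideal-onto : {Q : Pred Element ℓ} → IsPrimeIdeal L Q → ∃ λ x → ∀ b → Agree (ideal x) Q b
  ideal-onto {Q} prime with surjective (Q , prime)
  ... | x , onto = x , λ b → proj₁ (onto (Poset.Eq.refl X)) , proj₂ (onto (Poset.Eq.refl X))

module PrimeIdealProperties (L : BoundedDistributiveLattice ℓ ℓ ℓ) where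
  open BoundedDistributiveLattice L renaming (⊤ to ⊤ᴸ; ⊥ to ⊥ᴸ)

  ⊥∈ : ∀ {I} → IsPrimeIdeal L I → ⊥ᴸ ∈ I
  ⊥∈ I = IsPrimeIdeal.down-closed I (minimum _) (proj₂ (IsPrimeIdeal.nonempty I))

  ⊤∉ : ∀ {I} → IsPrimeIdeal L I → ⊤ᴸ ∉ I
  ⊤∉ I ⊤∈I = proj₂ (IsPrimeIdeal.proper I) (IsPrimeIdeal.down-closed I (maximum _) ⊤∈I)

  -- Each condition on a prime ideal can be tested on at most three lattice elements (non-emptiness
  -- at bottom, properness at top), so it passes to `Q` from a prime ideal that agrees with `Q` on
  -- those.
  primeIdeals-closed : {Q : Pred Carrier ℓ} →
    (∀ bs → Σ[ J ∈ PrimeIdeal L ] All (Agree (proj₁ J) Q) bs) → IsPrimeIdeal L Q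
  primeIdeals-closed {Q} approx = record
    { isIdeal = record
      { nonempty = ⊥ᴸ , bottom
      ; down-closed = down
      ; ∨-closed = join
      }
    ; proper = ⊤ᴸ , top
    ; prime = meet
    }
    where
    bottom : ⊥ᴸ ∈ Q
    bottom with approx (⊥ᴸ ∷ [])
    ... | (_ , J) , ((to , _) ∷ []) = to (⊥∈ J)

    top : ⊤ᴸ ∉ Q
    top ⊤∈Q with approx (⊤ᴸ ∷ [])
    ... | (_ , J) , ((_ , from) ∷ []) = ⊤∉ J (from ⊤∈Q)

    down : ∀ {a b} → a ≤ b → b ∈ Q → a ∈ Q
    down {a} {b} a≤b b∈Q with approx (a ∷ b ∷ [])
    ... | (_ , J) , ((to , _) ∷ (_ , from) ∷ []) = to (IsPrimeIdeal.down-closed J a≤b (from b∈Q))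

    join : ∀ {a b} → a ∈ Q → b ∈ Q → a ∨ b ∈ Q
    join {a} {b} a∈Q b∈Q with approx (a ∷ b ∷ a ∨ b ∷ [])
    ... | (_ , J) , ((_ , from-a) ∷ (_ , from-b) ∷ (to , _) ∷ []) =
      to (IsPrimeIdeal.∨-closed J (from-a a∈Q) (from-b b∈Q))

    meet : ∀ {a b} → a ∧ b ∈ Q → a ∈ Q ⊎ b ∈ Q
    meet {a} {b} ab∈Q with approx (a ∷ b ∷ a ∧ b ∷ [])
    ... | (_ , J) , ((to-a , _) ∷ (to-b , _) ∷ (_ , from) ∷ []) =
      Sum.map to-a to-b (IsPrimeIdeal.prime J (from ab∈Q))

-- Representability by a closed embedding

-- Reading x ⊩ g as "g lies in the prime ideal x" turns X into a subset of the
-- power 2^G; the hypothesis `closed` says that this subset is topologically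
-- closed.  The representing lattice consists of the lattice terms over G,
-- preordered by their values at the points of X.
module ClosedEmbedding (em : ExcludedMiddle ℓ) (X : Poset ℓ ℓ ℓ) {G : Set ℓ}
  (_⊩_ : Poset.Carrier X → G → Set ℓ)
  (⊩-mono : ∀ {x y} → Poset._≤_ X x y → ∀ g → x ⊩ g → y ⊩ g)
  (⊩-cancel : ∀ {x y} → (∀ g → x ⊩ g → y ⊩ g) → Poset._≤_ X x y)
  (closed : (P : Pred G ℓ) → (∀ gs → ∃ λ x → All (Agree (x ⊩_) P) gs) →
            ∃ λ x → ∀ g → Agree (x ⊩_) P g)
  where

  open Poset X using (Carrier; _≤_; module Eq; antisym; reflexive)

  data Term : Set ℓ where
    var : G → Term
    ⊤ᵗ ⊥ᵗ : Term
    _∧ᵗ_ _∨ᵗ_ : Term → Term → Term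

  -- The clauses are forced on a prime ideal with generators `P`: primality turns meets into
  -- disjunctions and closure under joins turns joins into conjunctions. Ideals being down-sets,
  -- `_≤ᵗ_` below reverses implication.
  InIdeal : Pred G ℓ → Pred Term ℓ
  InIdeal P (var g) = P g
  InIdeal P ⊤ᵗ = Lift ℓ ⊥
  InIdeal P ⊥ᵗ = ⊤
  InIdeal P (s ∧ᵗ t) = InIdeal P s ⊎ InIdeal P t
  InIdeal P (s ∨ᵗ t) = InIdeal P s × InIdeal P t

  ideal : Carrier → Pred Term ℓ
  ideal x = InIdeal (x ⊩_)

  _≤ᵗ_ _≈ᵗ_ : Term → Term → Set ℓ
  s ≤ᵗ t = ∀ x → ideal x t → ideal x s
  s ≈ᵗ t = s ≤ᵗ t × t ≤ᵗ s

  termLattice : BoundedDistributiveLattice ℓ ℓ ℓ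
  termLattice = record
    { boundedLattice = record
      { Carrier = Term ; _≈_ = _≈ᵗ_ ; _≤_ = _≤ᵗ_
      ; _∨_ = _∨ᵗ_ ; _∧_ = _∧ᵗ_ ; ⊤ = ⊤ᵗ ; ⊥ = ⊥ᵗ
      ; isBoundedLattice = record
        { isLattice = record
          { isPartialOrder = record
            { isPreorder = record
              { isEquivalence = record
                { refl = (λ _ → id) , (λ _ → id)
                ; sym = λ (p , q) → q , p
                ; trans = λ (p , q) (r , s) → (λ x → p x ∘ r x) , (λ x → s x ∘ q x)
                }
              ; reflexive = proj₁
              ; trans = λ p q x → p x ∘ q x
              }
            ; antisym = _,_
            }
          ; supremum = λ s t → (λ _ → proj₁) , (λ _ → proj₂) , λ u p q x z → p x z , q x z
          ; infimum = λ s t → (λ _ → inj₁) , (λ _ → inj₂) , λ u p q x → Sum.[ p x , q x ]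
          }
        ; maximum = λ t x ()
        ; minimum = λ t x _ → tt
        }
      }
    ; ∧-distribˡ-∨ = λ s t u →
        (λ { x (inj₁ p , _) → inj₁ p
           ; x (inj₂ _ , inj₁ q) → inj₁ q
           ; x (inj₂ p , inj₂ q) → inj₂ (p , q) }) ,
        (λ { x (inj₁ p) → inj₁ p , inj₁ p
           ; x (inj₂ (p , q)) → inj₂ p , inj₂ q })
    }

  ideal-isPrime : ∀ x → IsPrimeIdeal termLattice (ideal x)
  ideal-isPrime x = record
    { isIdeal = record
      { nonempty = ⊥ᵗ , tt
      ; down-closed = λ s≤t → s≤t x
      ; ∨-closed = _,_
      }
    ; proper = ⊤ᵗ , lower
    ; prime = id
    }

  ideal-mono : ∀ {x y} → x ≤ y → ideal x ⊆ ideal y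
  ideal-mono x≤y {var g} p = ⊩-mono x≤y g p
  ideal-mono x≤y {⊥ᵗ} p = tt
  ideal-mono x≤y {s ∧ᵗ t} (inj₁ p) = inj₁ (ideal-mono x≤y {s} p)
  ideal-mono x≤y {s ∧ᵗ t} (inj₂ p) = inj₂ (ideal-mono x≤y {t} p)
  ideal-mono x≤y {s ∨ᵗ t} (p , q) = ideal-mono x≤y {s} p , ideal-mono x≤y {t} q

  ideal-cancel : ∀ {x y} → ideal x ⊆ ideal y → x ≤ y
  ideal-cancel p = ⊩-cancel λ g → p {var g}

  module _ {I : Pred Term ℓ} (I-prime : IsPrimeIdeal termLattice I) where
    open IsPrimeIdeal I-prime
    open PrimeIdealProperties termLattice

    -- A finite test for agreement with `I`: a point whose ideal contains `inside gs` but not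
    -- `outside gs` treats every generator in `gs` as `I` does. Primality makes `I` itself pass the
    -- test.
    inside outside : List G → Term
    inside [] = ⊥ᵗ
    inside (g ∷ gs) with em {I (var g)}
    ... | yes _ = var g ∨ᵗ inside gs
    ... | no _ = inside gs
    outside [] = ⊤ᵗ
    outside (g ∷ gs) with em {I (var g)}
    ... | yes _ = outside gs
    ... | no _ = var g ∧ᵗ outside gs

    inside∈I : ∀ gs → inside gs ∈ I
    inside∈I [] = ⊥∈ I-prime
    inside∈I (g ∷ gs) with em {I (var g)}
    ... | yes p = ∨-closed p (inside∈I gs)
    ... | no _ = inside∈I gs

    outside∉I : ∀ gs → outside gs ∉ I
    outside∉I [] = ⊤∉ I-prime
    outside∉I (g ∷ gs) with em {I (var g)}
    ... | yes _ = outside∉I gs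
    ... | no ¬p = Sum.[ ¬p , outside∉I gs ] ∘ prime

    separated⇒agree : ∀ {x} gs → ideal x (inside gs) → ¬ ideal x (outside gs) →
                      All (Agree (x ⊩_) (I ∘ var)) gs
    separated⇒agree [] _ _ = []
    separated⇒agree (g ∷ gs) i o with em {I (var g)}
    ... | yes p = ((λ _ → p) , (λ _ → proj₁ i)) ∷ separated⇒agree gs (proj₂ i) o
    ... | no ¬p = ((λ q → ⊥-elim (o (inj₁ q))) , (λ p → contradiction p ¬p))
                ∷ separated⇒agree gs i (o ∘ inj₂)

    -- If no point passed the test, `outside gs` would lie below `inside gs` in the term lattice and
    -- hence belong to `I`.
    approximation : ∀ gs → ∃ λ x → All (Agree (x ⊩_) (I ∘ var)) gs
    approximation gs with em {∃ λ x → All (Agree (x ⊩_) (I ∘ var)) gs}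
    ... | yes p = p
    ... | no none = contradiction (down-closed outside≤inside (inside∈I gs)) (outside∉I gs)
      where
      outside≤inside : outside gs ≤ᵗ inside gs
      outside≤inside x i with em {ideal x (outside gs)}
      ... | yes o = o
      ... | no ¬o = contradiction (x , separated⇒agree gs i ¬o) none

    agree-everywhere : ∀ {x} → (∀ g → Agree (x ⊩_) (I ∘ var) g) → ∀ t → Agree (ideal x) I t
    agree-everywhere agree (var g) = agree g
    agree-everywhere agree ⊤ᵗ = (λ ()) , (λ p → contradiction p (⊤∉ I-prime))
    agree-everywhere agree ⊥ᵗ = (λ _ → ⊥∈ I-prime) , (λ _ → tt)
    agree-everywhere agree (s ∧ᵗ t) with agree-everywhere agree s | agree-everywhere agree t
    ... | to-s , from-s | to-t , from-t =
      Sum.[ down-closed (λ _ → inj₁) ∘ to-s , down-closed (λ _ → inj₂) ∘ to-t ] ,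
      Sum.map from-s from-t ∘ prime
    agree-everywhere agree (s ∨ᵗ t) with agree-everywhere agree s | agree-everywhere agree t
    ... | to-s , from-s | to-t , from-t =
      (λ (p , q) → ∨-closed (to-s p) (to-t q)) ,
      (λ p → from-s (down-closed (λ _ → proj₁) p) , from-t (down-closed (λ _ → proj₂) p))

  representable : Representable X
  representable = termLattice , (λ x → ideal x , ideal-isPrime x) , record
    { isOrderMonomorphism = record
      { isOrderHomomorphism = record
        { cong = λ x≈y → (λ {t} → ideal-mono (reflexive x≈y) {t})
                       , (λ {t} → ideal-mono (reflexive (Eq.sym x≈y)) {t})
        ; mono = λ x≤y {t} → ideal-mono x≤y {t}
        }
      ; injective = λ (p , q) →
          antisym (ideal-cancel (λ {t} → p {t})) (ideal-cancel (λ {t} → q {t}))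
      ; cancel = λ p → ideal-cancel (λ {t} → p {t})
      }
    ; surjective = λ (I , I-prime) →
        let x , agree = closed (I ∘ var) (approximation I-prime)
            same = agree-everywhere I-prime agree
        in x , λ {z} z≈x → (λ {t} p → proj₁ (same t) (ideal-mono (reflexive z≈x) {t} p))
                         , (λ {t} p → ideal-mono (reflexive (Eq.sym z≈x)) {t} (proj₂ (same t) p))
    }

-- Gluing the components

-- The components other than that of x₀ converge to x₀ because their points are
-- told apart from x₀ by the generators `flag`, `coflag` and `local` only.
module ComponentGluing (em : ExcludedMiddle ℓ) (ac : AxiomOfChoice ℓ) (X : Poset ℓ ℓ ℓ)
  (components : ∀ Y → IsOrderComponent X Y → Representable (induced X Y))
  (x₀ : Poset.Carrier X) where

  open Poset X using (Carrier; _≤_) renaming (refl to ≤-refl)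

  Component : Carrier → Pred Carrier ℓ
  Component = TransClosure (Comparable X)

  ≤⇒connected : ∀ {x y} → x ≤ y → Component x y
  ≤⇒connected x≤y = [ inj₁ x≤y ]

  connectedness : Setoid ℓ ℓ
  connectedness = record
    { Carrier = Carrier
    ; _≈_ = Component
    ; isEquivalence = record
      { refl = ≤⇒connected ≤-refl
      ; sym = symmetric (Comparable X) Sum.swap
      ; trans = _⁺++⁺_
      }
    }

  -- Representatives turn connectedness into an equality, so that all points of a component share
  -- one lattice, that of `At` at the representative.
  rep : Carrier → Carrier
  rep = proj₁ (ac connectedness)

  rep-connected : ∀ x → Component (rep x) x
  rep-connected = proj₁ (proj₂ (ac connectedness))

  rep-cong : ∀ {x y} → Component x y → rep x ≡ rep y
  rep-cong = proj₂ (proj₂ (ac connectedness))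

  i₀ : Carrier
  i₀ = rep x₀

  member : ∀ {x i} → rep x ≡ i → Component i x
  member {x} refl = rep-connected x

  module At (i : Carrier) =
    Representation (induced X (Component i)) (components (Component i) (i , id , id))

  retract : Carrier → Σ Carrier (Component i₀)
  retract x with em {rep x ≡ i₀}
  ... | yes p = x , member p
  ... | no _ = x₀ , rep-connected x₀

  retract-inside : ∀ {x} → rep x ≡ i₀ → proj₁ (retract x) ≡ x
  retract-inside {x} p with em {rep x ≡ i₀}
  ... | yes _ = refl
  ... | no ¬p = contradiction p ¬p

  retract-outside : ∀ {x} → rep x ≢ i₀ → proj₁ (retract x) ≡ x₀
  retract-outside {x} ¬p with em {rep x ≡ i₀}
  ... | yes p = contradiction p ¬p
  ... | no _ = refl

  ≡⇒≤ : ∀ {x y} → x ≡ y → x ≤ y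
  ≡⇒≤ refl = ≤-refl

  retract-mono : ∀ {x y} → x ≤ y → proj₁ (retract x) ≤ proj₁ (retract y)
  retract-mono {x} {y} x≤y with em {rep x ≡ i₀} | em {rep y ≡ i₀}
  ... | yes _ | yes _ = x≤y
  ... | no _  | no _  = ≤-refl
  ... | yes p | no ¬q = contradiction (trans (sym (rep-cong (≤⇒connected x≤y))) p) ¬q
  ... | no ¬p | yes q = contradiction (trans (rep-cong (≤⇒connected x≤y)) q) ¬p

  -- A component is an up-set and a down-set, so both membership and non-membership are preserved
  -- upwards. `coflag` keeps points of the component of `x₀` from lying below points of other
  -- components.
  data Generator : Set ℓ where
    flag coflag : Carrier → Generator
    local : ∀ i → At.Element i → Generator
    base : At.Element i₀ → Generator

  In : Carrier → Carrier → Set ℓ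
  In x i = rep x ≡ i × i ≢ i₀

  _⊩_ : Carrier → Generator → Set ℓ
  x ⊩ flag i = In x i
  x ⊩ coflag i = ¬ In x i
  x ⊩ local i b = Σ[ p ∈ In x i ] At.ideal i (x , member (proj₁ p)) b
  x ⊩ base b = At.ideal i₀ (retract x) b

  ⊩-mono : ∀ {x y} → x ≤ y → ∀ g → x ⊩ g → y ⊩ g
  ⊩-mono x≤y (flag i) (p , q) = trans (sym (rep-cong (≤⇒connected x≤y))) p , q
  ⊩-mono x≤y (coflag i) ¬p (p , q) = ¬p (trans (rep-cong (≤⇒connected x≤y)) p , q)
  ⊩-mono x≤y (local i b) ((p , q) , r) =
    (trans (sym (rep-cong (≤⇒connected x≤y))) p , q) , At.ideal-mono i x≤y r
  ⊩-mono x≤y (base b) r = At.ideal-mono i₀ (retract-mono x≤y) r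

  ⊩-cancel : ∀ {x y} → (∀ g → x ⊩ g → y ⊩ g) → x ≤ y
  ⊩-cancel {x} {y} h with em {rep x ≡ i₀} | em {rep y ≡ i₀}
  -- The flag of `x` forces `y` into the same component, where the `local` generators compare the
  -- two.
  ... | no ¬p | _ = At.ideal-cancel (rep x) {x = x , member refl}
                      {y = y , member (proj₁ (h (flag (rep x)) (refl , ¬p))) } λ {b} r →
    let q , s = h (local (rep x) b) ((refl , ¬p) , r)
    in At.ideal-mono (rep x) ≤-refl s
  ... | yes p | yes q =
    subst (_≤ y) (retract-inside p) (subst (_ ≤_) (retract-inside q)
      (At.ideal-cancel i₀ {x = retract x} {y = retract y} λ {b} → h (base b)))
  ... | yes p | no ¬q = ⊥-elim (h (coflag (rep y)) (λ (r , _) → ¬q (trans (sym r) p)) (refl , ¬q))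

  module _ (P : Pred Generator ℓ) (approx : ∀ gs → ∃ λ x → All (Agree (x ⊩_) P) gs) where

    -- Approximants tested on `flag i` lie in component `i`. Hence the trace of `P` on `local i` is
    -- a pointwise limit of prime ideals of that component's lattice, and so comes from a point of
    -- it.
    flagged : ∀ {i} → P (flag i) → ∃ λ x → ∀ g → Agree (x ⊩_) P g
    flagged {i} Pi = x , agree
      where
      local-prime : IsPrimeIdeal (At.L i) (P ∘ local i)
      local-prime = PrimeIdealProperties.primeIdeals-closed (At.L i) approx-local
        where
        approx-local : ∀ bs → Σ[ J ∈ PrimeIdeal (At.L i) ] All (Agree (proj₁ J) (P ∘ local i)) bs
        approx-local bs with approx (flag i ∷ map (local i) bs)
        ... | y , ((_ , from) ∷ agree) =
          At.point i (y , member (proj₁ (from Pi))) ,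
          All.map (λ (to , back) → (λ r → to (from Pi , r))
                                  , (λ q → At.ideal-mono i ≤-refl (proj₂ (back q))))
                  (All.map⁻ agree)

      x : Carrier
      x = proj₁ (proj₁ (At.ideal-onto i local-prime))

      x∈i : Component i x
      x∈i = proj₂ (proj₁ (At.ideal-onto i local-prime))

      agree-local : ∀ b → Agree (At.ideal i (x , x∈i)) (P ∘ local i) b
      agree-local = proj₂ (At.ideal-onto i local-prime)

      In-x : In x i
      In-x with approx (flag i ∷ [])
      ... | y , ((_ , from) ∷ []) with from Pi
      ... | p , q = trans (rep-cong (symmetric (Comparable X) Sum.swap x∈i ⁺++⁺ member p)) p , q

      flag-unique : ∀ {j} → P (flag j) → i ≡ j
      flag-unique {j} Pj with approx (flag i ∷ flag j ∷ [])
      ... | y , ((_ , from-i) ∷ (_ , from-j) ∷ []) =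
        trans (sym (proj₁ (from-i Pi))) (proj₁ (from-j Pj))

      agree : ∀ g → Agree (x ⊩_) P g
      agree (flag j) = (λ (p , _) → subst (P ∘ flag) (trans (sym (proj₁ In-x)) p) Pi)
                     , (λ Pj → subst (In x) (flag-unique Pj) In-x)
      agree (coflag j) with approx (flag j ∷ coflag j ∷ [])
      ... | y , ((to , from) ∷ (to-co , from-co) ∷ []) =
        (λ ¬p → to-co (λ p → ¬p (subst (In x) (flag-unique (to p)) In-x)))
        , (λ Pj p → from-co Pj (from (subst (P ∘ flag) (trans (sym (proj₁ In-x)) (proj₁ p)) Pi)))
      agree (local j b) = to , from
        where
        to : x ⊩ local j b → P (local j b)
        to (p , r) with trans (sym (proj₁ In-x)) (proj₁ p)
        ... | refl = proj₁ (agree-local b) (At.ideal-mono i ≤-refl r)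
        from : P (local j b) → x ⊩ local j b
        from Pjb with approx (flag j ∷ local j b ∷ [])
        ... | y , ((to-j , _) ∷ (_ , from-jb) ∷ []) with flag-unique (to-j (proj₁ (from-jb Pjb)))
        ... | refl = In-x , At.ideal-mono i ≤-refl (proj₂ (agree-local b) Pjb)
      -- Both `x` and the approximant `y` lie outside the component of `x₀`, so both retract to
      -- `x₀`.
      agree (base b) with approx (flag i ∷ base b ∷ [])
      ... | y , ((_ , from-i) ∷ (to-b , from-b) ∷ []) =
        (λ r → to-b (At.ideal-mono i₀ (≡⇒≤ (trans x↦x₀ (sym y↦x₀))) r))
        , (λ Pb → At.ideal-mono i₀ (≡⇒≤ (trans y↦x₀ (sym x↦x₀))) (from-b Pb))
        where
        outside : ∀ {z} → In z i → proj₁ (retract z) ≡ x₀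
        outside (p , q) = retract-outside (λ r → q (trans (sym p) r))
        x↦x₀ = outside In-x
        y↦x₀ = outside (from-i Pi)

    -- Here the approximants may wander through other components, but their retractions stay in that
    -- of `x₀`, and the limit is taken there.
    unflagged : (∀ i → ¬ P (flag i)) → ∃ λ x → ∀ g → Agree (x ⊩_) P g
    unflagged none = x , agree
      where
      base-prime : IsPrimeIdeal (At.L i₀) (P ∘ base)
      base-prime = PrimeIdealProperties.primeIdeals-closed (At.L i₀) λ bs →
        let y , agree = approx (map base bs) in At.point i₀ (retract y) , All.map⁻ agree

      x : Carrier
      x = proj₁ (proj₁ (At.ideal-onto i₀ base-prime))

      x∈i₀ : Component i₀ x
      x∈i₀ = proj₂ (proj₁ (At.ideal-onto i₀ base-prime))

      agree-base : ∀ b → Agree (At.ideal i₀ (x , x∈i₀)) (P ∘ base) b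
      agree-base = proj₂ (At.ideal-onto i₀ base-prime)

      rep-x : rep x ≡ i₀
      rep-x = rep-cong (symmetric (Comparable X) Sum.swap x∈i₀ ⁺++⁺ rep-connected x₀)

      not-In : ∀ {j} → ¬ In x j
      not-In (p , q) = q (trans (sym p) rep-x)

      agree : ∀ g → Agree (x ⊩_) P g
      agree (flag j) = (λ p → ⊥-elim (not-In p)) , (λ Pj → ⊥-elim (none j Pj))
      agree (coflag j) with approx (flag j ∷ coflag j ∷ [])
      ... | y , ((to , _) ∷ (to-co , _) ∷ []) = (λ _ → to-co (none j ∘ to)) , (λ _ → not-In)
      agree (local j b) with approx (flag j ∷ local j b ∷ [])
      ... | y , ((to , _) ∷ (_ , from) ∷ []) =
        (λ (p , _) → ⊥-elim (not-In p)) , (λ Pjb → ⊥-elim (none j (to (proj₁ (from Pjb)))))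
      agree (base b) =
        (λ r → proj₁ (agree-base b) (At.ideal-mono i₀ (≡⇒≤ (retract-inside rep-x)) r))
        , (λ Pb → At.ideal-mono i₀ (≡⇒≤ (sym (retract-inside rep-x))) (proj₂ (agree-base b) Pb))

    closed : ∃ λ x → ∀ g → Agree (x ⊩_) P g
    closed with em {∃ λ i → P (flag i)}
    ... | yes (i , Pi) = flagged Pi
    ... | no none = unflagged λ i Pi → none (i , Pi)

  representable : Representable X
  representable = ClosedEmbedding.representable em X _⊩_ ⊩-mono ⊩-cancel closed

empty-representable : ExcludedMiddle ℓ → (X : Poset ℓ ℓ ℓ) → ¬ Poset.Carrier X → Representable X
empty-representable em X empty = ClosedEmbedding.representable em X {G = ⊤} (λ _ _ → ⊤)
  (λ _ _ _ → tt) (λ {x} _ → contradiction x empty)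
  (λ P approx → contradiction (proj₁ (approx [])) empty)

components-representable⇒representable : ExcludedMiddle ℓ → AxiomOfChoice ℓ → (X : Poset ℓ ℓ ℓ) →
  (∀ Y → IsOrderComponent X Y → Representable (induced X Y)) → Representable X
components-representable⇒representable em ac X components with em {Poset.Carrier X}
... | yes x₀ = ComponentGluing.representable em ac X components x₀
... | no empty = empty-representable em X empty

-- Ultrafilters

record Ultrafilter (I : Set ℓ) : Set (lsuc ℓ) where
  field
    Most : Pred (Pred I ℓ) ℓ
    inhabited : ∀ {Q} → Most Q → ∃ Q
    most-∩ : ∀ {Q R} → Most Q → Most R → Most (Q ∩ R)
    most-mono : ∀ {Q R} → Q ⊆ R → Most Q → Most R
    decide : ∀ Q → Most Q ⊎ Most (∁ Q)

  most-everything : ∀ {Q} → (∀ i → Q i) → Most Q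
  most-everything {Q} all with decide Q
  ... | inj₁ m = m
  ... | inj₂ m with inhabited m
  ... | i , ¬q = contradiction (all i) ¬q

  most-All : {K : Set ℓ} {Q : K → Pred I ℓ} {ks : List K} →
             All (λ k → Most (Q k)) ks → Most (λ i → All (λ k → Q k i) ks)
  most-All [] = most-everything λ _ → []
  most-All (m ∷ ms) = most-mono (λ (q , qs) → q ∷ qs) (most-∩ m (most-All ms))

-- The ultrafilter lemma

module UltrafilterLemma (em : ExcludedMiddle ℓ) (ac : AxiomOfChoice ℓ) {I : Set ℓ} where

  -- Boolean-valued subsets keep the power set of `I` at level `ℓ`, where choice and `Stage` can use
  -- it.
  Subset : Set ℓ
  Subset = I → Bool

  χ : {A : Set ℓ} → Pred A ℓ → A → Bool
  χ Q a = does (em {Q a})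

  χ-true : {A : Set ℓ} (Q : Pred A ℓ) {a : A} → Q a → χ Q a ≡ true
  χ-true Q {a} q with em {Q a}
  ... | yes _ = refl
  ... | no ¬q = contradiction q ¬q

  χ-sound : {A : Set ℓ} (Q : Pred A ℓ) {a : A} → χ Q a ≡ true → Q a
  χ-sound Q {a} eq with em {Q a}
  ... | yes q = q

  χ-cong : {A : Set ℓ} {Q R : Pred A ℓ} → Q ≐ R → ∀ a → χ Q a ≡ χ R a
  χ-cong {Q = Q} {R} (Q⊆R , R⊆Q) a with em {Q a} | em {R a}
  ... | yes _ | yes _ = refl
  ... | no _  | no _  = refl
  ... | yes q | no ¬r = contradiction (Q⊆R q) ¬r
  ... | no ¬q | yes r = contradiction (R⊆Q r) ¬q

  Common : List Subset → Pred I ℓ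
  Common bs i = All (λ b → b i ≡ true) bs

  FIP : Pred (Pred Subset ℓ) ℓ
  FIP S = ∀ {bs} → All S bs → ∃ (Common bs)

  New : Pred Subset ℓ → Pred Subset ℓ
  New S b = b ∉ S × (∀ {bs} → All S bs → ∃ (Common (b ∷ bs)))

  ⟦_⟧ : (Subset → Bool) → Pred Subset ℓ
  ⟦ C ⟧ b = Lift ℓ (C b ≡ true)

  pick : (Subset → Bool) → Maybe Subset
  pick C with em {∃ (New ⟦ C ⟧)}
  ... | yes (b , _) = just b
  ... | no _ = nothing

  pick-new : ∀ {C b} → pick C ≡ just b → New ⟦ C ⟧ b
  pick-new {C} eq with em {∃ (New ⟦ C ⟧)}
  pick-new refl | yes (_ , new) = new

  pick-exists : ∀ {C b} → New ⟦ C ⟧ b → ∃ λ c → pick C ≡ just c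
  pick-exists {C} new with em {∃ (New ⟦ C ⟧)}
  ... | yes (c , _) = c , refl
  ... | no none = contradiction (_ , new) none

  families : Setoid ℓ ℓ
  families = record
    { Carrier = Subset → Bool
    ; _≈_ = λ C D → ∀ b → C b ≡ D b
    ; isEquivalence = record
      { refl = λ _ → refl
      ; sym = λ p b → sym (p b)
      ; trans = λ p q b → trans (p b) (q b)
      }
    }

  -- Choosing from the canonical representative makes the added set depend on
  -- the extension of S only.
  canonical : Pred Subset ℓ → Subset → Bool
  canonical S = proj₁ (ac families) (χ S)

  canonical-cong : ∀ {S T} → S ≐ T → canonical S ≡ canonical T
  canonical-cong S≐T = proj₂ (proj₂ (ac families)) (χ-cong S≐T)

  canonical-≐ : ∀ S → ⟦ canonical S ⟧ ≐ S
  canonical-≐ S =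
    (λ {b} (lift p) → χ-sound S (trans (sym (same b)) p)) ,
    (λ {b} p → lift (trans (same b) (χ-true S p)))
    where same = proj₁ (proj₂ (ac families)) (χ S)

  New-cong : ∀ {S T} → S ≐ T → New S ⊆ New T
  New-cong (S⊆T , T⊆S) (b∉S , common) = b∉S ∘ T⊆S , common ∘ All.map T⊆S

  step : Pred Subset ℓ → Pred Subset ℓ
  step S b = S b ⊎ pick (canonical S) ≡ just b

  step-cong : ∀ {S T} → S ≐ T → step S ⊆ step T
  step-cong S≐T (inj₁ p) = inj₁ (proj₁ S≐T p)
  step-cong S≐T (inj₂ p) = inj₂ (trans (cong pick (sym (canonical-cong S≐T))) p)

  -- Reduces finite intersections in the enlarged family to those that `New` controls: `c` together
  -- with a list from `S`.
  split : ∀ {S : Pred Subset ℓ} {c bs} → All (λ b → S b ⊎ just c ≡ just b) bs →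
          ∃ λ cs → All S cs × (Common (c ∷ cs) ⊆ Common bs)
  split [] = [] , [] , λ _ → []
  split (inj₂ refl ∷ ps) with split ps
  ... | cs , qs , f = cs , qs , λ { (q ∷ r) → q ∷ f (q ∷ r) }
  split (_∷_ {x = b} (inj₁ p) ps) with split ps
  ... | cs , qs , f = b ∷ cs , p ∷ qs , λ { (q ∷ r ∷ s) → r ∷ f (q ∷ s) }

  step-FIP : ∀ {S} → FIP S → FIP (step S)
  step-FIP {S} fip ps with pick (canonical S) in eq
  ... | nothing = fip (All.map (λ { (inj₁ p) → p }) ps)
  ... | just c with split ps
  ... | cs , qs , f with proj₂ (New-cong (canonical-≐ S) (pick-new eq)) qs
  ... | i , common = i , f common

  module FromMaximal (U : Pred Subset ℓ) (U-FIP : FIP U) (maximal : ∀ {b} → ¬ New U b) where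

    blocked : ∀ {b} → b ∉ U → ∃ λ bs → All U bs × ¬ ∃ (Common (b ∷ bs))
    blocked {b} b∉U with em {∃ λ bs → All U bs × ¬ ∃ (Common (b ∷ bs))}
    ... | yes p = p
    ... | no none = ⊥-elim (maximal (b∉U , extend))
      where
      extend : ∀ {bs} → All U bs → ∃ (Common (b ∷ bs))
      extend {bs} ps with em {∃ (Common (b ∷ bs))}
      ... | yes p = p
      ... | no ¬p = contradiction (bs , ps , ¬p) none

    -- If both were missing, each would be blocked by a finite list from `U`. A point common to the
    -- two lists lies in `b` or in its complement, contradicting one of the blocks.
    complement∈U : ∀ {b} → b ∉ U → not ∘ b ∈ U
    complement∈U {b} b∉U with em {U (not ∘ b)}
    ... | yes p = p
    ... | no ¬p with blocked b∉U | blocked ¬p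
    ... | bs , ps , no-bs | cs , qs , no-cs with U-FIP (All.++⁺ ps qs)
    ... | i , common with All.++⁻ bs common | b i in eq
    ... | in-bs , in-cs | true = ⊥-elim (no-bs (i , eq ∷ in-bs))
    ... | in-bs , in-cs | false = ⊥-elim (no-cs (i , cong not eq ∷ in-cs))

    U-upward : ∀ {bs c} → All U bs → (∀ {i} → Common bs i → c i ≡ true) → U c
    U-upward {c = c} ps f with em {U c}
    ... | yes p = p
    ... | no c∉U with U-FIP (complement∈U c∉U ∷ ps)
    ... | i , ci≡f ∷ common with c i | f common
    U-upward ps f | no _ | _ , () ∷ _ | .true | refl

    ultrafilter : Ultrafilter I
    ultrafilter = record
      { Most = λ Q → U (χ Q)
      ; inhabited = λ {Q} m → let i , common = U-FIP (m ∷ []) in i , χ-sound Q (All.head common)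
      ; most-∩ = λ {Q} {R} m n → U-upward (m ∷ n ∷ []) λ { (q ∷ r ∷ []) →
          χ-true (Q ∩ R) (χ-sound Q q , χ-sound R r) }
      ; most-mono = λ {Q} {R} Q⊆R m →
          U-upward (m ∷ []) λ { (q ∷ []) → χ-true R (Q⊆R (χ-sound Q q)) }
      ; decide = decide
      }
      where
      decide : ∀ Q → U (χ Q) ⊎ U (χ (∁ Q))
      decide Q with em {U (χ Q)}
      ... | yes m = inj₁ m
      ... | no ¬m = inj₂ (U-upward (complement∈U ¬m ∷ []) λ { {i} (p ∷ []) →
                      χ-true (∁ Q) λ q → case-false (χ-true Q q) p })
        where
        case-false : ∀ {b} → b ≡ true → not b ≡ true → ⊥
        case-false refl ()

  module Stages (base : Pred Subset ℓ) (base-FIP : FIP base) where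

    -- The transfinite iteration of `step`; a union of families of subsets of I is
    -- a union of at most Subset-many of them, so limits can be indexed by Subset.
    data Stage : Set ℓ where
      start : Stage
      next : Stage → Stage
      lim : (Subset → Stage) → Stage

    family : Stage → Pred Subset ℓ
    family start = base
    family (next t) = step (family t)
    family (lim f) b = ∃ λ c → family (f c) b

    base⊆family : ∀ t → base ⊆ family t
    base⊆family start p = p
    base⊆family (next t) p = inj₁ (base⊆family t p)
    base⊆family (lim f) p = (λ _ → true) , base⊆family (f _) p

    -- The dichotomy from the Bourbaki-Witt argument: no family lies strictly between a stage and
    -- its successor. It sharpens totality so that the induction passes through `next`.
    Below : Stage → Stage → Set ℓ
    Below x y = family x ⊆ family y ⊎ family (next y) ⊆ family x

    -- The delicate case is that of two stages with the same family; there the added set agrees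
    -- because `step` respects extensional equality.
    next-below : ∀ x y → Below x y → Below y x → Below (next x) y
    next-below x y (inj₂ y⁺⊆x) _ = inj₂ (inj₁ ∘ y⁺⊆x)
    next-below x y (inj₁ _) (inj₂ x⁺⊆y) = inj₁ x⁺⊆y
    next-below x y (inj₁ x⊆y) (inj₁ y⊆x) = inj₂ (step-cong (y⊆x , x⊆y))

    lim-below : ∀ f y → (∀ c → Below (f c) y) → Below (lim f) y
    lim-below f y below with em {∃ λ c → family (next y) ⊆ family (f c)}
    ... | yes (c , y⁺⊆fc) = inj₂ λ p → c , y⁺⊆fc p
    ... | no none = inj₁ λ (c , p) →
      Sum.[ (λ fc⊆y → fc⊆y p) , (λ y⁺⊆fc → ⊥-elim (none (c , λ {b} → y⁺⊆fc {b}))) ] (below c)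

    below : ∀ x y → Below x y
    below start y = inj₁ (base⊆family y)
    -- The exchange of arguments is well-founded: one stage gets smaller and the other is kept.
    below (next x) y = next-below x y (below x y) (below y x)
    below (lim f) y = lim-below f y λ c → below (f c) y

    family-total : ∀ x y → family x ⊆ family y ⊎ family y ⊆ family x
    family-total x y = Sum.map id (λ y⁺⊆x p → y⁺⊆x (inj₁ p)) (below x y)

    lim-finite : ∀ {f bs} → All (family (lim f)) bs → ∃ λ c → All (family (f c)) bs
    lim-finite [] = (λ _ → true) , []
    lim-finite {f} ((c , p) ∷ ps) with lim-finite {f} ps
    ... | d , qs with family-total (f c) (f d)
    ... | inj₁ fc⊆fd = d , fc⊆fd p ∷ qs
    ... | inj₂ fd⊆fc = c , p ∷ All.map fd⊆fc qs

    family-FIP : ∀ t → FIP (family t)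
    family-FIP start = base-FIP
    family-FIP (next t) = step-FIP (family-FIP t)
    family-FIP (lim f) ps with lim-finite {f} ps
    ... | c , qs = family-FIP (f c) qs

    stageOf : Subset → Stage
    stageOf b with em {∃ λ t → family t b}
    ... | yes (t , _) = t
    ... | no _ = start

    top : Stage
    top = lim stageOf

    -- `stageOf` selects, for every subset that ever enters, a stage containing it, and `top` unites
    -- the selected stages.
    family⊆top : ∀ t → family t ⊆ family top
    family⊆top t {b} p = b , in-stage
      where
      in-stage : family (stageOf b) b
      in-stage with em {∃ λ t → family t b}
      ... | yes (_ , q) = q
      ... | no none = contradiction (t , p) none

    -- Otherwise `step` would add a set outside `top`, although the next stage is already contained
    -- in `top`.
    top-maximal : ∀ {b} → ¬ New (family top) b
    top-maximal new with pick-exists (New-cong (proj₂ same , proj₁ same) new)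
      where same = canonical-≐ (family top)
    ... | c , eq = proj₁ (New-cong (canonical-≐ (family top)) (pick-new eq))
                     (family⊆top (next top) (inj₂ eq))

  extend-to-ultrafilter : {J : Set ℓ} (F : J → Pred I ℓ) →
    (∀ js → ∃ λ i → All (λ j → F j i) js) →
    Σ[ V ∈ Ultrafilter I ] (∀ j → Ultrafilter.Most V (F j))
  extend-to-ultrafilter {J} F fip =
    FromMaximal.ultrafilter (family top) (family-FIP top) top-maximal ,
    λ j → base⊆family top (j , refl)
    where
    base : Pred Subset ℓ
    base b = ∃ λ j → b ≡ χ (F j)

    indices : ∀ {bs} → All base bs → ∃ λ js → ∀ {i} → All (λ j → F j i) js → Common bs i
    indices [] = [] , λ _ → []
    indices ((j , refl) ∷ ps) with indices ps
    ... | js , f = j ∷ js , λ { (p ∷ q) → χ-true (F j) p ∷ f q }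

    base-FIP : FIP base
    base-FIP ps with indices ps
    ... | js , f with fip js
    ... | i , p = i , f p

    open Stages base base-FIP

-- Limits along ultrafilters

module UltraLimit (X : Poset ℓ ℓ ℓ) (R : Representable X) {I : Set ℓ} (V : Ultrafilter I)
  (y : I → Poset.Carrier X) where

  open Poset X using (Carrier; _≤_)
  open Representation X R
  open Ultrafilter V

  limitIdeal : Pred Element ℓ
  limitIdeal b = Most (λ i → ideal (y i) b)

  -- On a finite list of elements, most of the ideals agree with the limit simultaneously.
  limitIdeal-prime : IsPrimeIdeal L limitIdeal
  limitIdeal-prime = PrimeIdealProperties.primeIdeals-closed L λ bs →
    let i , agree = inhabited (most-All (All.universal most-agree bs)) in point (y i) , agree
    where
    most-agree : ∀ b → Most (λ i → Agree (ideal (y i)) limitIdeal b)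
    most-agree b with decide (λ i → ideal (y i) b)
    ... | inj₁ m = most-mono (λ p → (λ _ → m) , (λ _ → p)) m
    ... | inj₂ m = most-mono (λ ¬p → (λ p → contradiction p ¬p) , ⊥-elim ∘ absurd) m
      where
      absurd : ¬ limitIdeal b
      absurd n = let _ , q , ¬q = inhabited (most-∩ n m) in ¬q q

  limit : Carrier
  limit = proj₁ (ideal-onto limitIdeal-prime)

  ∈limit : ∀ {b} → Agree (ideal limit) limitIdeal b
  ∈limit = proj₂ (ideal-onto limitIdeal-prime) _

  limit-≤ : ∀ {x} → Most (λ i → y i ≤ x) → limit ≤ x
  limit-≤ m = ideal-cancel λ b∈ →
    let _ , y≤x , p = inhabited (most-∩ m (proj₁ ∈limit b∈)) in ideal-mono y≤x p

  ≤-limit : ∀ {x} → Most (λ i → x ≤ y i) → x ≤ limit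
  ≤-limit m = ideal-cancel λ b∈ → proj₂ ∈limit (most-mono (λ x≤y → ideal-mono x≤y b∈) m)

-- The limit in X of an ultrafilter on Y that avoids all members of a cover is
-- comparable to a point of Y, hence lies in Y, but belongs to no member of the cover.
module AvoidedCover (em : ExcludedMiddle ℓ) (X : Poset ℓ ℓ ℓ) (R : Representable X)
  (Y : Pred (Poset.Carrier X) ℓ) (Y-component : IsOrderComponent X Y)
  {K : Set ℓ} (U : K → Pred (Σ (Poset.Carrier X) Y) ℓ)
  (U-open : ∀ k → IntervalOpen (induced X Y) (U k))
  (U-cover : ∀ x → ∃ λ k → x ∈ U k)
  (V : Ultrafilter (Σ (Poset.Carrier X) Y))
  (avoided : ∀ k → Ultrafilter.Most V (∁ (U k))) where

  open Poset X using (Carrier) renaming (refl to ≤-refl)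
  open Ultrafilter V
  open UltraLimit X R V proj₁

  S : Σ Carrier Y ⊎ Σ Carrier Y → Pred (Σ Carrier Y) ℓ
  S = intervalSubbase (induced X Y)

  Excluded : Σ Carrier Y → Set ℓ
  Excluded x = ∃ λ k → S k x × Most (∁ (S k))

  -- Otherwise `V` would contain every subbasic neighbourhood of `x`, hence meet the complement of a
  -- cover member inside a basic neighbourhood contained in that member.
  excluded : ∀ x → Excluded x
  excluded x with em {Excluded x}
  ... | yes p = p
  ... | no ¬p =
    let k , x∈Uk = U-cover x
        _ , x∈⋂ , ⋂⊆Uk = U-open k x∈Uk
        _ , z∈⋂ , z∉Uk = inhabited
          (most-∩ (most-All {Q = S} (All.map (λ {k} → included k) x∈⋂)) (avoided k))
    in contradiction (⋂⊆Uk z∈⋂) z∉Uk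
    where
    included : ∀ k → S k x → Most (S k)
    included k x∈Sk with decide (S k)
    ... | inj₁ m = m
    ... | inj₂ m = contradiction (k , x∈Sk , m) ¬p

  stable : {P : Pred (Σ Carrier Y) ℓ} → Most (∁ (∁ P)) → Most P
  stable {P} m with decide P
  ... | inj₁ n = n
  ... | inj₂ n = let _ , ¬¬p , ¬p = inhabited (most-∩ m n) in contradiction ¬p ¬¬p

  Y-closed : ∀ {x y} → Y x → Comparable X x y → Y y
  Y-closed x∈Y x∼y = proj₂ (proj₂ Y-component) (proj₁ (proj₂ Y-component) x∈Y ⁺∷ʳ x∼y)

  limit∈Y : Y limit
  -- Any point of `Y` serves here. Excluding it puts some (x] or [x) with x in `Y` into `V`, which
  -- makes the limit comparable to x.
  limit∈Y with excluded (proj₁ Y-component , proj₂ (proj₂ Y-component) [ inj₁ ≤-refl ])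
  ... | inj₁ (_ , x∈Y) , _ , m = Y-closed x∈Y (inj₂ (limit-≤ (stable m)))
  ... | inj₂ (_ , x∈Y) , _ , m = Y-closed x∈Y (inj₁ (≤-limit (stable m)))

  impossible : ⊥
  impossible with excluded (limit , limit∈Y)
  ... | inj₁ _ , limit≰x , m = limit≰x (limit-≤ (stable m))
  ... | inj₂ _ , x≰limit , m = x≰limit (≤-limit (stable m))

-- Without a finite subcover the complements of the cover have the finite intersection property and
-- extend to an ultrafilter.
component-compact : ExcludedMiddle ℓ → AxiomOfChoice ℓ → (X : Poset ℓ ℓ ℓ) → Representable X →
  ∀ Y → IsOrderComponent X Y → Compact (IntervalOpen (induced X Y))
component-compact em ac X R Y Y-component {K} U U-open U-cover
  with em {Σ[ ks ∈ List K ] (∀ x → Any (λ k → x ∈ U k) ks)}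
... | yes p = p
... | no none =
  let V , avoided = UltrafilterLemma.extend-to-ultrafilter em ac (λ k → ∁ (U k)) missed
  in ⊥-elim (AvoidedCover.impossible em X R Y Y-component U U-open U-cover V avoided)
  where
  missed : ∀ ks → ∃ λ x → All (λ k → ∁ (U k) x) ks
  missed ks with em {∃ λ x → All (λ k → ∁ (U k) x) ks}
  ... | yes p = p
  ... | no ¬p = contradiction (ks , covers) none
    where
    covers : ∀ x → Any (λ k → x ∈ U k) ks
    covers x with em {Any (λ k → x ∈ U k) ks}
    ... | yes q = q
    ... | no ¬q = contradiction (x , All.¬Any⇒All¬ ks ¬q) ¬p

-- Countable posets in which every point is the limit of a chain

LimitOf : {A : Set ℓ} → (A → A → Set ℓ) → (ℕ → A) → A → Set ℓ
LimitOf _⊑_ y x =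
  (∀ {m n} → m ℕ.≤ n → y m ⊑ y n) × (∀ n → y n ⊑ x) × (∀ z → (∀ n → y n ⊑ z) → x ⊑ z)

FreeUltrafilter : ∀ ℓ → Set (lsuc ℓ)
FreeUltrafilter ℓ =
  Σ[ V ∈ Ultrafilter (Lift ℓ ℕ) ] (∀ k → Ultrafilter.Most V (λ n → Lift ℓ (k ℕ.≤ lower n)))

-- Baire category: the clopen sets {x : a ∈ x, b ∉ x} have no isolated points, so
-- they can be shrunk to avoid the points of X one after the other.
module ChainLimits (em : ExcludedMiddle ℓ) (V-free : FreeUltrafilter ℓ) (X : Poset ℓ ℓ ℓ)
  (e : ℕ → Poset.Carrier X) (e-onto : ∀ x → ∃ λ n → Poset._≈_ X x (e n))
  (approach : ∀ x → Σ[ y ∈ (ℕ → Poset.Carrier X) ] (∀ n → ¬ Poset._≈_ X (y n) x) ×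
    (LimitOf (Poset._≤_ X) y x ⊎ LimitOf (flip (Poset._≤_ X)) y x))
  (R : Representable X) where

  open Poset X using (Carrier; _≈_; antisym; reflexive; module Eq)
    renaming (_≤_ to _⊑_)
  open Representation X R
  open BoundedDistributiveLattice L using (supremum; infimum)
    renaming (_≤_ to _≤ᴸ_; refl to ≤ᴸ-refl; trans to ≤ᴸ-trans)
  open Ultrafilter (proj₁ V-free)

  isPrime : ∀ x → IsPrimeIdeal L (ideal x)
  isPrime x = proj₂ (point x)

  module Limit (y : ℕ → Carrier) = UltraLimit X R (proj₁ V-free) (y ∘ lower)

  eventually : {Q : Pred ℕ ℓ} → ∀ k → (∀ n → k ℕ.≤ n → Q n) → Most (Q ∘ lower)
  eventually k q = most-mono (λ {n} (lift k≤n) → q (lower n) k≤n) (proj₂ V-free k)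

  -- Bounds pass to the ultrafilter limit. Freeness makes each chain member a bound for most later
  -- ones, so the limit is the supremum or infimum.
  chain-limit : ∀ {y x} → LimitOf _⊑_ y x ⊎ LimitOf (flip _⊑_) y x → Limit.limit y ≈ x
  chain-limit {y} (inj₁ (mono , upper , least)) = antisym
    (Limit.limit-≤ y (most-everything λ n → upper (lower n)))
    (least _ λ k → Limit.≤-limit y (eventually k λ n → mono))
  chain-limit {y} (inj₂ (mono , lower′ , greatest)) = antisym
    (greatest _ λ k → Limit.limit-≤ y (eventually k λ n → mono))
    (Limit.≤-limit y (most-everything λ n → lower′ (lower n)))

  record Box : Set ℓ where
    constructor box
    field
      {a b} : Element
      centre : Carrier
      a∈ : ideal centre a
      b∉ : ¬ ideal centre b

  _∈ᴮ_ : Carrier → Box → Set ℓ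
  x ∈ᴮ B = ideal x (Box.a B) × ¬ ideal x (Box.b B)

  -- Stated on the bounding elements; inclusion of the clopen sets follows because ideals are
  -- down-closed.
  record _⊆ᴮ_ (C B : Box) : Set ℓ where
    constructor _,_
    field
      a-≤ : Box.a B ≤ᴸ Box.a C
      b-≤ : Box.b C ≤ᴸ Box.b B

  -- The approaching chain converges to the centre and the box is clopen, so most of the chain lies
  -- in the box.
  another : ∀ (B : Box) → ∃ λ x → x ∈ᴮ B × ¬ (x ≈ Box.centre B)
  another B@(box x a∈ b∉) with approach x
  ... | y , y≉x , limit = y (lower (proj₁ near)) , proj₂ near , y≉x _
    where
    same = chain-limit limit
    most-a : Most (λ n → ideal (y (lower n)) (Box.a B))
    most-a = proj₁ (Limit.∈limit y) (ideal-mono (reflexive (Eq.sym same)) a∈)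
    most-b : Most (λ n → ¬ ideal (y (lower n)) (Box.b B))
    most-b with decide (λ n → ideal (y (lower n)) (Box.b B))
    ... | inj₁ m = contradiction (ideal-mono (reflexive same) (proj₂ (Limit.∈limit y) m)) b∉
    ... | inj₂ m = m
    near = inhabited (most-∩ most-a most-b)

  otherwise : ∀ (B : Box) p → ∃ λ x → x ∈ᴮ B × ¬ (x ≈ p)
  otherwise B p with em {Box.centre B ≈ p}
  ... | no c≉p = Box.centre B , (Box.a∈ B , Box.b∉ B) , c≉p
  ... | yes c≈p with another B
  ... | x , x∈B , x≉c = x , x∈B , λ x≈p → x≉c (Eq.trans x≈p (Eq.sym c≈p))

  ⋢⇒separated : ∀ {x y} → ¬ (x ⊑ y) → ∃ λ c → ideal x c × ¬ ideal y c
  ⋢⇒separated {x} {y} x⋢y with em {∃ λ c → ideal x c × ¬ ideal y c}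
  ... | yes p = p
  ... | no none = contradiction (ideal-cancel below) x⋢y
    where
    below : ideal x ⊆ ideal y
    below {c} c∈x with em {ideal y c}
    ... | yes p = p
    ... | no ¬p = contradiction (c , c∈x , ¬p) none

  -- Recentre at a point `x` other than `p`. An element in `x` but not in `p` is joined to `a`;
  -- failing that, one in `p` but not in `x` is met with `b`.
  avoid : ∀ (B : Box) p → Σ[ C ∈ Box ] C ⊆ᴮ B × ¬ (p ∈ᴮ C)
  avoid B p with otherwise B p
  ... | x , (a∈x , b∉x) , x≉p with em {x ⊑ p}
  ... | no x⋢p with ⋢⇒separated x⋢p
  ...   | c , c∈x , c∉p =
    box x (IsPrimeIdeal.∨-closed (isPrime x) a∈x c∈x) b∉x ,
    (proj₁ (supremum _ _) , ≤ᴸ-refl) ,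
    λ (ac∈p , _) → c∉p (IsPrimeIdeal.down-closed (isPrime p) (proj₁ (proj₂ (supremum _ _))) ac∈p)
  avoid B p | x , (a∈x , b∉x) , x≉p | yes x⊑p with ⋢⇒separated (λ p⊑x → x≉p (antisym x⊑p p⊑x))
  ...   | c , c∈p , c∉x =
    box x a∈x (λ bc∈x → Sum.[ b∉x , c∉x ] (IsPrimeIdeal.prime (isPrime x) bc∈x)) ,
    (≤ᴸ-refl , proj₁ (infimum _ _)) ,
    λ (_ , bc∉p) → bc∉p (IsPrimeIdeal.down-closed (isPrime p) (proj₁ (proj₂ (infimum _ _))) c∈p)

  boxes : ℕ → Box
  -- Bottom and top cut out the whole space; index `suc n` then leaves out `e n`.
  boxes zero = box (e 0) (⊥∈ (isPrime (e 0))) (⊤∉ (isPrime (e 0)))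
    where open PrimeIdealProperties L
  boxes (suc n) = proj₁ (avoid (boxes n) (e n))

  boxes-nested : ∀ {m n} → m ℕ.≤ n → boxes n ⊆ᴮ boxes m
  boxes-nested {m} {n} m≤n with m≤n⇒m<n∨m≡n m≤n
  ... | inj₂ refl = ≤ᴸ-refl , ≤ᴸ-refl
  boxes-nested {m} {suc n} _ | inj₁ (s≤s m≤n)
    with boxes-nested m≤n | proj₁ (proj₂ (avoid (boxes n) (e n)))
  ... | p , q | r , s = ≤ᴸ-trans p r , ≤ᴸ-trans s q

  centres : ℕ → Carrier
  centres n = Box.centre (boxes n)

  limit∈boxes : ∀ k → Limit.limit centres ∈ᴮ boxes k
  limit∈boxes k = proj₂ (Limit.∈limit centres) (eventually k in-a) , out-b
    where
    in-a : ∀ n → k ℕ.≤ n → ideal (centres n) (Box.a (boxes k))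
    in-a n k≤n = IsPrimeIdeal.down-closed (isPrime (centres n))
      (_⊆ᴮ_.a-≤ (boxes-nested k≤n)) (Box.a∈ (boxes n))
    out-b : ¬ ideal (Limit.limit centres) (Box.b (boxes k))
    out-b b∈ with inhabited (most-∩ (proj₁ (Limit.∈limit centres) b∈) (proj₂ V-free k))
    ... | lift n , b∈n , lift k≤n =
      Box.b∉ (boxes n) (IsPrimeIdeal.down-closed (isPrime (centres n))
        (_⊆ᴮ_.b-≤ (boxes-nested k≤n)) b∈n)

  impossible : ⊥
  impossible with e-onto (Limit.limit centres)
  ... | n , z≈en = proj₂ (proj₂ (avoid (boxes n) (e n)))
    ( ideal-mono (reflexive z≈en) (proj₁ (limit∈boxes (suc n)))
    , λ b∈ → proj₂ (limit∈boxes (suc n)) (ideal-mono (reflexive (Eq.sym z≈en)) b∈) )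

free-ultrafilter : ExcludedMiddle ℓ → AxiomOfChoice ℓ → FreeUltrafilter ℓ
free-ultrafilter {ℓ} em ac =
  let V , free = UltrafilterLemma.extend-to-ultrafilter em ac tail bounded
  in V , λ k → free (lift k)
  where
  tail : Lift ℓ ℕ → Pred (Lift ℓ ℕ) ℓ
  tail k n = Lift ℓ (lower k ℕ.≤ lower n)

  bounded : ∀ ks → ∃ λ n → All (λ k → tail k n) ks
  bounded [] = lift 0 , []
  bounded (lift k ∷ ks) with bounded ks
  ... | lift n , ps = lift (k ⊔ n) ,
    lift (m≤m⊔n k n) ∷ All.map (λ (lift p) → lift (ℕ.≤-trans p (m≤n⊔m k n))) ps

-- The alternating tree

-- A finite or infinite sequence x of natural numbers is coded by
-- W σ n = "x extends σ ∷ʳ m for some m ≤ n".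
Code : Set
Code = List ℕ → ℕ → Bool

-- Each axiom relates only two values of `W`, which makes the codes a closed set.
record IsCode (W : Code) : Set where
  field
    mono : ∀ σ {n} → W σ n ≡ true → W σ (suc n) ≡ true
    descend : ∀ σ {m τ n} → W (σ ++ m ∷ τ) n ≡ true → W σ m ≡ true
    exclude : ∀ σ {m τ n} → W (σ ++ suc m ∷ τ) n ≡ true → W σ m ≡ false

  mono-≤ : ∀ σ {m n} → m ℕ.≤ n → W σ m ≡ true → W σ n ≡ true
  mono-≤ σ {m} {n} m≤n p with m≤n⇒m<n∨m≡n m≤n
  ... | inj₂ refl = p
  mono-≤ σ {m} {suc n} _ p | inj₁ (s≤s m≤n) = mono σ (mono-≤ σ m≤n p)

shift : ℕ → Code → Code
shift m W σ = W (m ∷ σ)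

shift-isCode : ∀ m {W} → IsCode W → IsCode (shift m W)
shift-isCode m c = record
  { mono = λ σ → mono (m ∷ σ)
  ; descend = λ σ → descend (m ∷ σ)
  ; exclude = λ σ → exclude (m ∷ σ)
  }
  where open IsCode c

stop : Code
stop _ _ = false

-- Prefixes `m` to the sequence coded by `W`; `stop` is the empty sequence.
go : ℕ → Code → Code
go m W [] n = does (m ≤? n)
go m W (k ∷ σ) n = W σ n Bool.∧ does (k ≟ m)

code : List ℕ → Code
code [] = stop
code (m ∷ ρ) = go m (code ρ)

does-true : {P : Set} (P? : Dec P) → does P? ≡ true → P
does-true (yes p) _ = p

go-isCode : ∀ m {W} → IsCode W → IsCode (go m W)
go-isCode j {W} c = record { mono = mono′ ; descend = descend′ ; exclude = exclude′ }
  where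
  open IsCode c
  mono′ : ∀ σ {n} → go j W σ n ≡ true → go j W σ (suc n) ≡ true
  mono′ [] {n} p = dec-true (j ≤? suc n) (ℕ.m≤n⇒m≤1+n (does-true (j ≤? n) p))
  mono′ (k ∷ σ) {n} p rewrite ∧-conicalʳ (W σ n) _ p | mono σ (∧-conicalˡ (W σ n) _ p) = refl
  descend′ : ∀ σ {m τ n} → go j W (σ ++ m ∷ τ) n ≡ true → go j W σ m ≡ true
  descend′ [] {m} {τ} {n} p = dec-true (j ≤? m)
    (ℕ.≤-reflexive (sym (does-true (m ≟ j) (∧-conicalʳ (W τ n) _ p))))
  descend′ (k ∷ σ) {m} {τ} {n} p
    rewrite ∧-conicalʳ (W (σ ++ m ∷ τ) n) _ p | descend σ (∧-conicalˡ (W (σ ++ m ∷ τ) n) _ p) = refl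
  exclude′ : ∀ σ {m τ n} → go j W (σ ++ suc m ∷ τ) n ≡ true → go j W σ m ≡ false
  exclude′ [] {m} {τ} {n} p with does-true (suc m ≟ j) (∧-conicalʳ (W τ n) _ p)
  ... | refl = dec-false (suc m ≤? m) (ℕ.n≮n m)
  exclude′ (k ∷ σ) {m} {τ} {n} p
    rewrite exclude σ (∧-conicalˡ (W (σ ++ suc m ∷ τ) n) _ p) = refl

code-isCode : ∀ ρ → IsCode (code ρ)
code-isCode [] = record { mono = λ _ () ; descend = λ _ () ; exclude = λ _ () }
code-isCode (m ∷ ρ) = go-isCode m (code-isCode ρ)

-- The truth value that counts as the larger one at the node.
sign : Bool → List ℕ → Bool
sign s [] = s
sign s (_ ∷ σ) = sign (not s) σ

-- For s = false the children σ ∷ʳ 0, σ ∷ʳ 1, … of a node σ increase to σ when σ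
-- has even length, and decrease to σ when it has odd length.
_≤⟨_⟩_ : Code → Bool → Code → Set
V ≤⟨ s ⟩ W = ∀ σ n → V σ n ≡ sign s σ → W σ n ≡ sign s σ

≤⟨⟩-antisym : ∀ {s V W} → V ≤⟨ s ⟩ W → W ≤⟨ s ⟩ V → ∀ σ n → V σ n ≡ W σ n
≤⟨⟩-antisym {s} {V} {W} p q σ n with V σ n Bool.≟ sign s σ
... | yes v = trans v (sym (p σ n v))
... | no ¬v = trans (¬-not ¬v) (sym (¬-not (¬v ∘ q σ n)))

≗⇒≤⟨⟩ : ∀ {s V W} → (∀ σ n → V σ n ≡ W σ n) → V ≤⟨ s ⟩ W
≗⇒≤⟨⟩ eq σ n p = trans (sym (eq σ n)) p

∧-mapˡ : ∀ {a b t} c → (a ≡ t → b ≡ t) → a Bool.∧ c ≡ t → b Bool.∧ c ≡ t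
∧-mapˡ {a} {b} true f p rewrite ∧-identityʳ a | ∧-identityʳ b = f p
∧-mapˡ {a} {b} false f p rewrite ∧-zeroʳ a | ∧-zeroʳ b = p

go-mono : ∀ {s} m {V W} → V ≤⟨ not s ⟩ W → go m V ≤⟨ s ⟩ go m W
go-mono m p [] n = id
go-mono m p (k ∷ σ) n = ∧-mapˡ (does (k ≟ m)) (p σ n)

Rising : (Code → Code → Set) → (ℕ → Code) → Code → Set
Rising _⊑_ y x = (∀ {m n} → m ℕ.≤ n → y m ⊑ y n) × (∀ n → y n ⊑ x)

-- A common first entry can be stripped at the cost of flipping the sign, which leaves the children
-- of the root.
children-monotone : ∀ s ρ → let y = λ n → code (ρ ∷ʳ n) in
  Rising _≤⟨ s ⟩_ y (code ρ) ⊎ Rising (flip _≤⟨ s ⟩_) y (code ρ)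
children-monotone s (m ∷ ρ) = Sum.map
  (λ (chain , bound) → (λ i≤j → go-mono m (chain i≤j)) , (λ n → go-mono m (bound n)))
  (λ (chain , bound) → (λ i≤j → go-mono m (chain i≤j)) , (λ n → go-mono m (bound n)))
  (children-monotone (not s) ρ)
children-monotone false [] = inj₁ (chain , λ { n [] k _ → refl ; n (_ ∷ _) k → id })
  where
  chain : ∀ {m n} → m ℕ.≤ n → go m stop ≤⟨ false ⟩ go n stop
  chain {m} {n} m≤n [] k p = dec-false (n ≤? k) λ n≤k →
    not-¬ (dec-true (m ≤? k) (ℕ.≤-trans m≤n n≤k)) p
  chain m≤n (_ ∷ _) k = id
children-monotone true [] = inj₂ (chain , λ { n [] k () ; n (_ ∷ _) k → id })
  where
  chain : ∀ {m n} → m ℕ.≤ n → go n stop ≤⟨ true ⟩ go m stop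
  chain {m} {n} m≤n [] k p = dec-true (m ≤? k) (ℕ.≤-trans m≤n (does-true (n ≤? k) p))
  chain m≤n (_ ∷ _) k = id

-- The values at index `k` only see entries up to `k`, so the new entry `suc k` is invisible to
-- them.
children-converge : ∀ ρ σ k → code (ρ ∷ʳ suc k) σ k ≡ code ρ σ k
children-converge [] [] k = dec-false (suc k ≤? k) (ℕ.n≮n k)
children-converge [] (_ ∷ _) k = refl
children-converge (m ∷ ρ) [] k = refl
children-converge (m ∷ ρ) (j ∷ σ) k = cong (Bool._∧ does (j ≟ m)) (children-converge ρ σ k)

code-at-end : ∀ ρ n → code ρ ρ n ≡ false
code-at-end [] n = refl
code-at-end (m ∷ ρ) n = cong (Bool._∧ does (m ≟ m)) (code-at-end ρ n)

child-at-end : ∀ ρ n → code (ρ ∷ʳ n) ρ n ≡ true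
child-at-end [] n = dec-true (n ≤? n) ℕ.≤-refl
child-at-end (m ∷ ρ) n rewrite dec-true (m ≟ m) refl = trans (∧-identityʳ _) (child-at-end ρ n)

-- For a code, this says that the sequence has at most `N` entries.
Bounded : ℕ → Code → Set
Bounded zero W = ∀ σ n → W σ n ≡ false
Bounded (suc N) W = ∀ m → Bounded N (shift m W)

empty-root : ∀ {W} → IsCode W → (∀ n → W [] n ≡ false) → Bounded 0 W
empty-root c empty [] n = empty n
empty-root c empty (m ∷ σ) n = ¬-not λ p → not-¬ (IsCode.descend c [] p) (empty m)

-- Shifting reduces to an empty `W`. There the comparison forces `V` to be false at the root or at
-- all nodes of length one, according to sign and direction; either way at most one entry remains.
bounded-step : ∀ N s {V W} → IsCode V → V ≤⟨ s ⟩ W ⊎ W ≤⟨ s ⟩ V → Bounded N W → Bounded (suc N) V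
bounded-step (suc N) s c p b m = bounded-step N (not s) (shift-isCode m c)
  (Sum.map (λ q σ → q (m ∷ σ)) (λ q σ → q (m ∷ σ)) p) (b m)
bounded-step zero true c (inj₁ V≤W) b m σ =
  empty-root c (λ n → ¬-not λ p → not-¬ (V≤W [] n p) (b [] n)) (m ∷ σ)
bounded-step zero false c (inj₁ V≤W) b m =
  empty-root (shift-isCode m c) (λ n → ¬-not λ p → not-¬ (V≤W (m ∷ []) n p) (b (m ∷ []) n))
bounded-step zero false c (inj₂ W≤V) b m σ = empty-root c (λ n → W≤V [] n (b [] n)) (m ∷ σ)
bounded-step zero true c (inj₂ W≤V) b m =
  empty-root (shift-isCode m c) (λ n → W≤V (m ∷ []) n (b (m ∷ []) n))

first-step : ∀ {W} → IsCode W → ∀ n → W [] n ≡ true → ∃ λ m → ∀ k → W [] k ≡ does (m ≤? k)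
first-step c zero p = 0 , λ k → IsCode.mono-≤ c [] z≤n p
first-step {W} c (suc n) p with W [] n in eq
... | true = first-step c n eq
... | false = suc n , agree
  where
  agree : ∀ k → W [] k ≡ does (suc n ≤? k)
  agree k with suc n ≤? k
  ... | yes n<k = trans (IsCode.mono-≤ c [] n<k p) (sym (dec-true (suc n ≤? k) n<k))
  ... | no n≮k = trans (¬-not λ q → not-¬ (IsCode.mono-≤ c [] (ℕ.≤-pred (ℕ.≰⇒> n≮k)) q) eq)
                       (sym (dec-false (suc n ≤? k) n≮k))

-- If `W` extends a node with head `k`, then `descend` gives m ≤ k and `exclude` gives k ≤ m.
go-shift : ∀ {W m} → IsCode W → (∀ k → W [] k ≡ does (m ≤? k)) →
           ∀ σ n → W σ n ≡ go m (shift m W) σ n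
go-shift c first [] n = first n
go-shift {W} {m} c first (k ∷ σ) n with k ≟ m
... | yes refl rewrite dec-true (m ≟ m) refl = sym (∧-identityʳ _)
... | no k≢m rewrite dec-false (k ≟ m) k≢m =
  trans (¬-not λ p → k≢m (ℕ.≤-antisym (k≤m k p) (m≤k p))) (sym (∧-zeroʳ (W (m ∷ σ) n)))
  where
  m≤k : W (k ∷ σ) n ≡ true → m ℕ.≤ k
  m≤k p = does-true (m ≤? k) (trans (sym (first k)) (IsCode.descend c [] p))
  k≤m : ∀ k → W (k ∷ σ) n ≡ true → k ℕ.≤ m
  k≤m zero p = z≤n
  k≤m (suc k) p = ℕ.≰⇒> λ m≤k →
    not-¬ (dec-true (m ≤? k) m≤k) (trans (sym (first k)) (IsCode.exclude c [] p))

bounded⇒finite : ExcludedMiddle 0ℓ → ∀ N {W} → IsCode W → Bounded N W →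
                 ∃ λ ρ → ∀ σ n → W σ n ≡ code ρ σ n
bounded⇒finite em zero c b = [] , b
bounded⇒finite em (suc N) {W} c b with em {∃ λ n → W [] n ≡ true}
... | no none = [] , empty-root c λ n → ¬-not λ p → none (n , p)
... | yes (n , p) with first-step c n p
... | m , first with bounded⇒finite em N (shift-isCode m c) (b m)
... | ρ , eq = m ∷ ρ , λ σ n → trans (go-shift c first σ n) (go-cong σ n)
  where
  go-cong : ∀ σ n → go m (shift m W) σ n ≡ go m (code ρ) σ n
  go-cong [] n = refl
  go-cong (k ∷ σ) n = cong (Bool._∧ does (k ≟ m)) (eq σ n)

-- Enumeration of the finite sequences

incrementHead : List ℕ → List ℕ
incrementHead [] = []
incrementHead (n ∷ ns) = suc n ∷ ns

-- Numerals are read as words in two letters: an entry m is one `2[1+_]` under m letters `1+[2_]`.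
decode : ℕᵇ → List ℕ
decode ℕᵇ.zero = []
decode 2[1+ b ] = 0 ∷ decode b
decode 1+[2 b ] = incrementHead (decode b)

decode-onto : ∀ ρ → ∃ λ b → decode b ≡ ρ
decode-onto [] = ℕᵇ.zero , refl
decode-onto (m ∷ ρ) with decode-onto ρ
... | b , refl = prepend m
  where
  prepend : ∀ m → ∃ λ c → decode c ≡ m ∷ decode b
  prepend zero = 2[1+ b ] , refl
  prepend (suc m) with prepend m
  ... | c , eq = 1+[2 c ] , cong incrementHead eq

-- The poset of all sequences and the component of the root

module AlternatingTree (em : ExcludedMiddle ℓ) where

  em₀ : ExcludedMiddle 0ℓ
  em₀ {P} = map′ lower lift (em {Lift ℓ P})

  Point : Set ℓ
  Point = Lift ℓ (Σ Code IsCode)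

  ⌊_⌋ : Point → Code
  ⌊ x ⌋ = proj₁ (lower x)

  isCode : ∀ x → IsCode ⌊ x ⌋
  isCode x = proj₂ (lower x)

  _⊑_ _≋_ : Point → Point → Set ℓ
  x ⊑ y = Lift ℓ (⌊ x ⌋ ≤⟨ false ⟩ ⌊ y ⌋)
  x ≋ y = x ⊑ y × y ⊑ x

  tree : Poset ℓ ℓ ℓ
  tree = record
    { Carrier = Point
    ; _≈_ = _≋_
    ; _≤_ = _⊑_
    ; isPartialOrder = record
      { isPreorder = record
        { isEquivalence = record
          { refl = λ {x} → ⊑-refl x , ⊑-refl x
          ; sym = λ (p , q) → q , p
          ; trans = λ {x} {y} {z} (p , q) (r , s) → ⊑-trans x y z p r , ⊑-trans z y x s q
          }
        ; reflexive = proj₁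
        ; trans = λ {x} {y} {z} → ⊑-trans x y z
        }
      ; antisym = _,_
      }
    }
    where
    ⊑-refl : ∀ x → x ⊑ x
    ⊑-refl _ = lift λ _ _ → id
    ⊑-trans : ∀ x y z → x ⊑ y → y ⊑ z → x ⊑ z
    ⊑-trans _ _ _ (lift p) (lift q) = lift λ σ n → q σ n ∘ p σ n

  Generator : Set ℓ
  Generator = Lift ℓ (List ℕ × ℕ)

  _⊩_ : Point → Generator → Set ℓ
  x ⊩ lift (σ , n) = Lift ℓ (⌊ x ⌋ σ n ≡ sign false σ)

  -- `W` is read off from `P`, and each axiom for it is inherited from a point that agrees with `P`
  -- at the two places involved.
  tree-closed : (P : Pred Generator ℓ) → (∀ gs → ∃ λ x → All (Agree (x ⊩_) P) gs) →
                ∃ λ x → ∀ g → Agree (x ⊩_) P g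
  tree-closed P approx = lift (W , W-isCode) , λ (lift (σ , n)) → W-agrees σ n
    where
    W : Code
    W σ n = if does (em {P (lift (σ , n))}) then sign false σ else not (sign false σ)

    W-agrees : ∀ σ n → Agree (λ _ → Lift ℓ (W σ n ≡ sign false σ)) P (lift (σ , n))
    W-agrees σ n with em {P (lift (σ , n))}
    ... | yes p = (λ _ → p) , (λ _ → lift refl)
    ... | no ¬p = (λ (lift eq) → contradiction (sym eq) (not-¬ refl)) , (λ p → contradiction p ¬p)

    W-value : ∀ {x} σ n → Agree (x ⊩_) P (lift (σ , n)) → W σ n ≡ ⌊ x ⌋ σ n
    W-value σ n (to , from) with em {P (lift (σ , n))}
    ... | yes p = sym (lower (from p))
    ... | no ¬p = sym (¬-not λ eq → ¬p (to (lift eq)))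

    locally : ∀ σ n τ k → ∃ λ x → W σ n ≡ ⌊ x ⌋ σ n × W τ k ≡ ⌊ x ⌋ τ k
    locally σ n τ k with approx (lift (σ , n) ∷ lift (τ , k) ∷ [])
    ... | x , (p ∷ q ∷ []) = x , W-value {x} σ n p , W-value {x} τ k q

    transfer : ∀ σ n τ k {s t} → (∀ x → ⌊ x ⌋ σ n ≡ s → ⌊ x ⌋ τ k ≡ t) → W σ n ≡ s → W τ k ≡ t
    transfer σ n τ k f p with locally σ n τ k
    ... | x , eq , eq′ = trans eq′ (f x (trans (sym eq) p))

    W-isCode : IsCode W
    W-isCode = record
      { mono = λ σ {n} → transfer σ n σ (suc n) λ x → IsCode.mono (isCode x) σ
      ; descend = λ σ {m} {τ} {n} → transfer (σ ++ m ∷ τ) n σ m λ x → IsCode.descend (isCode x) σ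
      ; exclude = λ σ {m} {τ} {n} → transfer (σ ++ suc m ∷ τ) n σ m λ x →
          IsCode.exclude (isCode x) σ
      }

  tree-representable : Representable tree
  tree-representable = ClosedEmbedding.representable em tree _⊩_
    (λ { (lift p) (lift (σ , n)) (lift q) → lift (p σ n q) })
    (λ p → lift λ σ n q → lower (p (lift (σ , n)) (lift q)))
    tree-closed

  finite : List ℕ → Point
  finite ρ = lift (code ρ , code-isCode ρ)

  Component : Pred Point ℓ
  Component = TransClosure (Comparable tree) (finite [])

  root∈Component : Component (finite [])
  root∈Component = [ inj₁ (Poset.refl tree {finite []}) ]

  comparable-bounded : ∀ {x y} N → Comparable tree x y → Bounded N ⌊ x ⌋ → Bounded (suc N) ⌊ y ⌋
  comparable-bounded {y = y} N x∼y =
    bounded-step N false (isCode y) (Sum.map lower lower (Sum.swap x∼y))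

  -- Each comparability adds at most one entry, so a finite path from the root never reaches an
  -- infinite sequence.
  component-bounded : ∀ {x y} N → Bounded N ⌊ x ⌋ → TransClosure (Comparable tree) x y →
                      ∃ λ M → Bounded M ⌊ y ⌋
  component-bounded {x} {y} N b [ x∼y ] = suc N , comparable-bounded {x} {y} N x∼y b
  component-bounded {x} N b (_∷_ {y = z} x∼z z∼y) =
    component-bounded {z} (suc N) (comparable-bounded {x} {z} N x∼z b) z∼y

  component-finite : ∀ {x} → Component x → ∃ λ ρ → x ≋ finite ρ
  component-finite {x} x∈C with component-bounded {finite []} 0 (λ _ _ → refl) x∈C
  ... | N , b with bounded⇒finite em₀ N (isCode x) b
  ... | ρ , eq = ρ , lift (≗⇒≤⟨⟩ eq) , lift (≗⇒≤⟨⟩ λ σ n → sym (eq σ n))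

  Y : Poset ℓ ℓ ℓ
  Y = induced tree Component

  enumerate : ℕ → Σ Point Component
  enumerate n with em {Component (finite (decode (fromℕ n)))}
  ... | yes p = _ , p
  ... | no _ = _ , root∈Component

  enumerate-decoded : ∀ n → Component (finite (decode (fromℕ n))) →
                      proj₁ (enumerate n) ≡ finite (decode (fromℕ n))
  enumerate-decoded n p with em {Component (finite (decode (fromℕ n)))}
  ... | yes _ = refl
  ... | no ¬p = contradiction p ¬p

  enumerate-onto : ∀ x → ∃ λ n → Poset._≈_ Y x (enumerate n)
  enumerate-onto (x , x∈C) with component-finite x∈C
  ... | ρ , x≋ρ with decode-onto ρ
  ... | b , refl = toℕ b , subst (x ≋_) (sym same) x≋ρ
    where
    decoded : decode (fromℕ (toℕ b)) ≡ decode b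
    decoded = cong decode (fromℕ-toℕ b)
    same : proj₁ (enumerate (toℕ b)) ≡ finite (decode b)
    same = trans
      (enumerate-decoded (toℕ b)
        (subst (Component ∘ finite) (sym decoded) (x∈C ⁺∷ʳ inj₁ (proj₁ x≋ρ))))
      (cong finite decoded)

  approach : ∀ x → Σ[ y ∈ (ℕ → Σ Point Component) ] (∀ n → ¬ Poset._≈_ Y (y n) x) ×
    (LimitOf (Poset._≤_ Y) y x ⊎ LimitOf (flip (Poset._≤_ Y)) y x)
  approach (x , x∈C) with component-finite x∈C
  ... | ρ , x⊑ρ , ρ⊑x = y , distinct , limit
    where
    open Poset tree using () renaming (trans to ⊑-trans)

    child : ℕ → Point
    child n = finite (ρ ∷ʳ n)

    comparable : ∀ n → Comparable tree x (child n)
    comparable n with children-monotone false ρ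
    ... | inj₁ (_ , bound) = inj₂ (⊑-trans {child n} {finite ρ} {x} (lift (bound n)) ρ⊑x)
    ... | inj₂ (_ , bound) = inj₁ (⊑-trans {x} {finite ρ} {child n} x⊑ρ (lift (bound n)))

    y : ℕ → Σ Point Component
    y n = child n , (x∈C ⁺∷ʳ comparable n)

    distinct : ∀ n → ¬ Poset._≈_ Y (y n) (x , x∈C)
    distinct n (p , q) = not-¬ (child-at-end ρ n) (trans
      (≤⟨⟩-antisym (lower (⊑-trans {child n} {x} {finite ρ} p x⊑ρ))
                   (lower (⊑-trans {finite ρ} {x} {child n} ρ⊑x q)) ρ n)
      (code-at-end ρ n))

    limit : LimitOf (Poset._≤_ Y) y (x , x∈C) ⊎ LimitOf (flip (Poset._≤_ Y)) y (x , x∈C)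
    limit with children-monotone false ρ
    ... | inj₁ (chain , bound) = inj₁
      ( (λ m≤n → lift (chain m≤n))
      , (λ n → ⊑-trans {child n} {finite ρ} {x} (lift (bound n)) ρ⊑x)
      -- At index `k` the child `suc k` has the same values as `ρ`, so bounding all children means
      -- bounding `ρ` value by value.
      , λ (z , _) above → ⊑-trans {x} {finite ρ} {z} x⊑ρ (lift λ σ k p →
          lower (above (suc k)) σ k (trans (children-converge ρ σ k) p)) )
    ... | inj₂ (chain , bound) = inj₂
      ( (λ m≤n → lift (chain m≤n))
      , (λ n → ⊑-trans {x} {finite ρ} {child n} x⊑ρ (lift (bound n)))
      , λ (z , _) below → ⊑-trans {z} {finite ρ} {x} (lift λ σ k p →
          trans (sym (children-converge ρ σ k)) (lower (below (suc k)) σ k p)) ρ⊑x )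

  not-representable : AxiomOfChoice ℓ → ¬ Representable Y
  not-representable ac =
    ChainLimits.impossible em (free-ultrafilter em ac) Y enumerate enumerate-onto approach

theorem1p1 : ∀ {ℓ} → ExcludedMiddle ℓ → AxiomOfChoice ℓ →
    ((X : Poset ℓ ℓ ℓ) →
    (∀ Y → IsOrderComponent X Y → Representable (induced X Y)) →
    Representable X)
    ×
    ((X : Poset ℓ ℓ ℓ) → Representable X →
    ∀ Y → IsOrderComponent X Y → Compact (IntervalOpen (induced X Y)))
    ×
    (Σ[ X ∈ Poset ℓ ℓ ℓ ] Representable X ×
    (Σ[ Y ∈ Pred (Poset.Carrier X) ℓ ]
    IsOrderComponent X Y × ¬ Representable (induced X Y)))
theorem1p1 em ac =
  components-representable⇒representable em ac ,
  component-compact em ac ,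
  tree , tree-representable , Component , (finite [] , id , id) , not-representable ac
  where open AlternatingTree em
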